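{- Let $A$ be a quasi implicative ordered combinatory algebra, and for $a,b\in A$ put $a\,\sharp\,b=\inf\{c\in A: a\le (b\to c)\}$. Then: (1) for all $a,b\in A$, $ab\le a\,\sharp\,b$; (2) if $A$ is an implicative ordered combinatory algebra with adjunctor $\mathsf e$, then for all $a,b\in A$, $(\mathsf e\, a)\,\sharp\, b\le ab$; (3) if $A$ is a full adjunction implicative ordered combinatory algebra, then for all $a,b\in A$, $a\,\sharp\,b=ab$.
   Context: A quasi implicative ordered combinatory algebra consists of an inf-complete partially ordered set $(A,\le)$ with a binary operation (application) $(a,b)\mapsto ab$, monotone in both arguments (associating to the left), a binary operation (implication) $(a,b)\mapsto a\to b$, antimonotone in the first and monotone in the second argument, elements $\mathsf s,\mathsf k\in A$ such that for all $a,b,c\in A$: $\mathsf k ab\le a$; $\mathsf s abc\le ac(bc)$; and (PA) if $a\le b\to c$ then $ab\le c$; together with a subset $\Phi\subseteq A$ (filter) closed under application containing $\mathsf s,\mathsf k$. It is an implicative ordered combinatory algebra (with adjunctor $\mathsf e$) if moreover there is $\mathsf e\in\Phi$ such that $ab\le c$ implies $\mathsf e a\le b\to c$. It is a full adjunction implicative ordered combinatory algebra if for all $a,b,c$, $ab\le c$ implies $a\le b\to c$. -}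

module Defs where

open import Data.Product using (_×_)
open import Level using (Level; _⊔_; suc)
open import Relation.Binary.Bundles using (Poset)
open import Relation.Binary.Definitions
  using (Monotonic₂; AntitonicMonotonic; _Respects_)
open import Relation.Unary using (Pred; _∈_)

module _ {c ℓ₁ ℓ₂} (P : Poset c ℓ₁ ℓ₂) where
  open Poset P

  IsInfimum : ∀ {ℓ} → Pred Carrier ℓ → Carrier → Set (c ⊔ ℓ₂ ⊔ ℓ)
  IsInfimum S m = (∀ x → x ∈ S → m ≤ x)
                × (∀ y → (∀ x → x ∈ S → y ≤ x) → y ≤ m)

  -- "Every subset has an infimum". Predicates must be given a universe
  -- level; we ask only for those valued in the universe of the order.
  -- A predicate valued in a smaller universe can be lifted to this one.
  record InfComplete : Set (c ⊔ ℓ₁ ⊔ suc ℓ₂) where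
    field
      ⋀           : Pred Carrier ℓ₂ → Carrier
      ⋀-isInfimum : ∀ S → IsInfimum S (⋀ S)

-- Equality of elements is the equivalence _≈_ of the underlying poset (the
-- case of _≡_ included), so the filter is required to respect it. Application
-- and implication respect it by their (anti)monotonicity and antisymmetry.
record QuasiImplicativeOCA (c ℓ₁ ℓ₂ ℓ₃ : Level)
       : Set (suc (c ⊔ ℓ₁ ⊔ ℓ₂ ⊔ ℓ₃)) where
  infixl 8 _·_
  infixr 7 _⇒_
  infixl 6 _♯_
  field
    poset       : Poset c ℓ₁ ℓ₂
    infComplete : InfComplete poset

  open Poset poset public
  open InfComplete infComplete public

  field
    _·_    : Carrier → Carrier → Carrier
    _⇒_    : Carrier → Carrier → Carrier
    s k    : Carrier
    ·-mono : Monotonic₂ _≤_ _≤_ _≤_ _·_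
    ⇒-mono : AntitonicMonotonic _≤_ _≤_ _≤_ _⇒_
    k-law  : ∀ a b → k · a · b ≤ a
    s-law  : ∀ a b c → s · a · b · c ≤ a · c · (b · c)
    PA     : ∀ a b c → a ≤ b ⇒ c → a · b ≤ c
    Φ      : Pred Carrier ℓ₃
    Φ-resp : Φ Respects _≈_
    Φ-·    : ∀ a b → a ∈ Φ → b ∈ Φ → a · b ∈ Φ
    s∈Φ    : s ∈ Φ
    k∈Φ    : k ∈ Φ

  _♯_ : Carrier → Carrier → Carrier
  a ♯ b = ⋀ (λ c → a ≤ b ⇒ c)

module _ {c ℓ₁ ℓ₂ ℓ₃} (A : QuasiImplicativeOCA c ℓ₁ ℓ₂ ℓ₃) where
  open QuasiImplicativeOCA A

  record IsImplicativeOCAWithAdjunctor (e : Carrier) : Set (c ⊔ ℓ₂ ⊔ ℓ₃) where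
    field
      e∈Φ     : e ∈ Φ
      adjunct : ∀ a b c → a · b ≤ c → e · a ≤ b ⇒ c

  record IsFullAdjunctionImplicativeOCA : Set (c ⊔ ℓ₂) where
    field
      adjunct : ∀ a b c → a · b ≤ c → a ≤ b ⇒ c

{-# OPTIONS --safe #-}
module Submission where

open import Defs
open import Data.Product using (_×_; _,_; proj₁; proj₂)

-- `PA` makes `a · b` a lower bound of the set whose infimum is `a ♯ b`. Conversely, an adjunction
-- applied to `a · b ≤ a · b` makes `a · b` a member of that set, so the infimum lies below it.

module _ {c ℓ₁ ℓ₂ ℓ₃} (A : QuasiImplicativeOCA c ℓ₁ ℓ₂ ℓ₃) where
  open QuasiImplicativeOCA A

  ♯-lower : ∀ {a b x} → a ≤ b ⇒ x → a ♯ b ≤ x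
  ♯-lower {x = x} = proj₁ (⋀-isInfimum _) x

  ♯-greatest : ∀ {a b y} → (∀ x → a ≤ b ⇒ x → y ≤ x) → y ≤ a ♯ b
  ♯-greatest {y = y} = proj₂ (⋀-isInfimum _) y

  ·≤♯ : ∀ a b → a · b ≤ a ♯ b
  ·≤♯ a b = ♯-greatest (PA a b)

mainTheorem1 : ∀ {c ℓ₁ ℓ₂ ℓ₃} (A : QuasiImplicativeOCA c ℓ₁ ℓ₂ ℓ₃) →
    let open QuasiImplicativeOCA A in
    (∀ a b → a · b ≤ a ♯ b)
    × (∀ e → IsImplicativeOCAWithAdjunctor A e →
    ∀ a b → (e · a) ♯ b ≤ a · b)
    × (IsFullAdjunctionImplicativeOCA A →
    ∀ a b → a ♯ b ≈ a · b)
mainTheorem1 A =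
    ·≤♯ A
  , (λ e isImpl a b →
      -- The adjunctor only gives `e · a ≤ b ⇒ a · b`, so `a · b` belongs to the set defining
      -- `(e · a) ♯ b`, hence the factor `e`.
      ♯-lower A (IsImplicativeOCAWithAdjunctor.adjunct isImpl a b (a · b) refl))
  , (λ isFull a b → antisym
      (♯-lower A (IsFullAdjunctionImplicativeOCA.adjunct isFull a b (a · b) refl))
      (·≤♯ A a b))
  where open QuasiImplicativeOCA A
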